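{- Let $\phi = \bigwedge_{i \in I} \phi_{i}$, with $I$ finite, where each $\phi_{i}$ is a formula disjunctive in the variable $x$. Then $\rho(\phi) \leq (N+1)(M+1)$, where $N$ is the number of distinct head subformulas of $\phi$ and $M$ is the number of distinct side subformulas occurring in any of the $\phi_{i}$.
   Context: Formulas are those of the Intuitionistic Propositional Calculus (IPC), built from propositional variables, $\top,\bot,\land,\vee,\to$; equality of formulas means provable equivalence in IPC. For a formula $\phi$ containing the variable $x$, $\phi^{0} = x$ and $\phi^{n+1} = \phi[\phi^{n}/x]$ (iterated substitution). The Ruitenburg number $\rho(\phi)$ is the least $n \geq 0$ such that $\phi^{n+2}$ and $\phi^{n}$ are provably equivalent in IPC. A formula is disjunctive in $x$ if it is generated by the grammar $\phi ::= x \mid \alpha \to \phi \mid \beta \vee \phi \mid \phi \vee \phi$, where $\alpha$ and $\beta$ are formulas not containing $x$; the formulas $\alpha$ occurring as leaves of this grammar in a parse are the head subformulas, the formulas $\beta$ the side subformulas. -}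

module Defs where

open import Data.Nat using (ℕ; zero; suc; _≟_)
open import Data.List using (List; []; _∷_; _++_; concatMap; foldr)
open import Data.List.Membership.Propositional using (_∈_)
open import Data.Product using (_×_)
open import Relation.Binary.PropositionalEquality using (_≡_; _≢_)
open import Relation.Nullary using (yes; no)

data Formula : Set where
  var  : ℕ → Formula
  ⊤'   : Formula
  ⊥'   : Formula
  _∧'_ : Formula → Formula → Formula
  _∨'_ : Formula → Formula → Formula
  _⇒_  : Formula → Formula → Formula

infixr 6 _∧'_
infixr 5 _∨'_
infixr 4 _⇒_

Ctx : Set
Ctx = List Formula

data _⊢_ : Ctx → Formula → Set where
  ax   : ∀ {Γ A} → A ∈ Γ → Γ ⊢ A
  ⊤I   : ∀ {Γ} → Γ ⊢ ⊤'
  ⊥E   : ∀ {Γ A} → Γ ⊢ ⊥' → Γ ⊢ A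
  ∧I   : ∀ {Γ A B} → Γ ⊢ A → Γ ⊢ B → Γ ⊢ (A ∧' B)
  ∧E₁  : ∀ {Γ A B} → Γ ⊢ (A ∧' B) → Γ ⊢ A
  ∧E₂  : ∀ {Γ A B} → Γ ⊢ (A ∧' B) → Γ ⊢ B
  ∨I₁  : ∀ {Γ A B} → Γ ⊢ A → Γ ⊢ (A ∨' B)
  ∨I₂  : ∀ {Γ A B} → Γ ⊢ B → Γ ⊢ (A ∨' B)
  ∨E   : ∀ {Γ A B C} → Γ ⊢ (A ∨' B) → (A ∷ Γ) ⊢ C → (B ∷ Γ) ⊢ C → Γ ⊢ C
  ⇒I   : ∀ {Γ A B} → (A ∷ Γ) ⊢ B → Γ ⊢ (A ⇒ B)
  ⇒E   : ∀ {Γ A B} → Γ ⊢ (A ⇒ B) → Γ ⊢ A → Γ ⊢ B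

_≈_ : Formula → Formula → Set
A ≈ B = ((A ∷ []) ⊢ B) × ((B ∷ []) ⊢ A)

NotIn : ℕ → Formula → Set
NotIn x (var y)   = x ≢ y
NotIn x ⊤'        = Data.Unit.⊤ where import Data.Unit
NotIn x ⊥'        = Data.Unit.⊤ where import Data.Unit
NotIn x (A ∧' B)  = NotIn x A × NotIn x B
NotIn x (A ∨' B)  = NotIn x A × NotIn x B
NotIn x (A ⇒ B)   = NotIn x A × NotIn x B

subst : ℕ → Formula → Formula → Formula
subst x ψ (var y) with x ≟ y
... | yes _ = ψ
... | no  _ = var y
subst x ψ ⊤'       = ⊤'
subst x ψ ⊥'       = ⊥'
subst x ψ (A ∧' B) = subst x ψ A ∧' subst x ψ B
subst x ψ (A ∨' B) = subst x ψ A ∨' subst x ψ B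
subst x ψ (A ⇒ B)  = subst x ψ A ⇒ subst x ψ B

iter : ℕ → Formula → ℕ → Formula
iter x φ zero    = var x
iter x φ (suc n) = subst x (iter x φ n) φ

-- Parse trees of formulas disjunctive in x:
--   φ ::= x | α → φ | β ∨ φ | φ ∨ φ    (α, β not containing x)
data Disj (x : ℕ) : Set where
  dvar : Disj x
  dimp : (α : Formula) → NotIn x α → Disj x → Disj x
  dsid : (β : Formula) → NotIn x β → Disj x → Disj x
  dor  : Disj x → Disj x → Disj x

⌜_⌝ : ∀ {x} → Disj x → Formula
⌜_⌝ {x} dvar       = var x
⌜ dimp α _ d ⌝ = α ⇒ ⌜ d ⌝
⌜ dsid β _ d ⌝ = β ∨' ⌜ d ⌝
⌜ dor d e ⌝    = ⌜ d ⌝ ∨' ⌜ e ⌝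

heads : ∀ {x} → Disj x → List Formula
heads dvar         = []
heads (dimp α _ d) = α ∷ heads d
heads (dsid _ _ d) = heads d
heads (dor d e)    = heads d ++ heads e

sides : ∀ {x} → Disj x → List Formula
sides dvar         = []
sides (dimp _ _ d) = sides d
sides (dsid β _ d) = β ∷ sides d
sides (dor d e)    = sides d ++ sides e

⋀ : ∀ {x} → List (Disj x) → Formula
⋀ ds = foldr (λ d acc → ⌜ d ⌝ ∧' acc) ⊤' ds

allHeads : ∀ {x} → List (Disj x) → List Formula
allHeads = concatMap heads

allSides : ∀ {x} → List (Disj x) → List Formula
allSides = concatMap sides

-- Every formula of `fs` is IPC-equivalent to some member of `L`.
-- A list L of length k with this property exists iff `fs` has at most k
-- distinct members (distinct = not provably equivalent).
CoveredBy : List Formula → List Formula → Set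
CoveredBy fs L = ∀ {f} → f ∈ fs → Data.List.Relation.Unary.Any.Any (f ≈_) L
  where import Data.List.Relation.Unary.Any

-- ρ(φ) ≤ k  iff  some n ≤ k has φ^{n+2} ≈ φ^n  (ρ is the least such n)
RuitenburgLE : ℕ → Formula → ℕ → Set
RuitenburgLE x φ k = Data.Product.∃ λ n → (n Data.Nat.≤ k) × (iter x φ (suc (suc n)) ≈ iter x φ n)

{-# OPTIONS --safe #-}

-- Let X n = φⁿ. If j exceeds the number of heads not yet provable in Γ, then
-- Γ proves X (j + 1) → X j. Indeed, by recursion on a disjunctive d,
-- d[X j] implies d[X (j - 1)] ∨ X j: at a head α provable in Γ one goes below
-- the implication, while at any other head the induction hypothesis in the
-- context α , Γ gives X j → X (j - 1), which the monotone d transports. Both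
-- disjuncts imply d[X (j - 1)], and the conjunction over all d is X j. As φ is
-- inflationary, ρ(φ) ≤ N + 1 ≤ (N + 1)(M + 1).
module Submission where

open import Defs
open import Data.Nat using (ℕ; zero; suc; _*_; _≤_; _≟_)
open import Data.Nat.Properties using (≤-refl; ≤-trans; ≤-reflexive; pred-mono-≤; m≤m*n; n≤1+n)
open import Data.List using (List; []; _∷_; length; foldr)
open import Data.List.Properties using (length-removeAt)
open import Data.List.Membership.Propositional using (_∈_)
open import Data.List.Relation.Binary.Subset.Propositional using (_⊆_)
open import Data.List.Relation.Binary.Subset.Propositional.Properties using (∷⁺ʳ)
open import Data.List.Relation.Unary.Any using (Any; here; there; index; _─_)
open import Data.List.Membership.Propositional.Properties using (∈-++⁺ˡ; ∈-++⁺ʳ)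
open import Data.Product using (_×_; _,_; ∃-syntax)
open import Data.Sum using (_⊎_; inj₁; inj₂)
open import Function using (_∘_)
open import Relation.Binary.PropositionalEquality using (_≡_; refl; sym; trans; cong; cong₂; subst₂)
open import Relation.Nullary using (yes; no; contradiction)

weaken : ∀ {Γ Δ A} → Γ ⊆ Δ → Γ ⊢ A → Δ ⊢ A
weaken σ (ax p)      = ax (σ p)
weaken σ ⊤I          = ⊤I
weaken σ (⊥E p)      = ⊥E (weaken σ p)
weaken σ (∧I p q)    = ∧I (weaken σ p) (weaken σ q)
weaken σ (∧E₁ p)     = ∧E₁ (weaken σ p)
weaken σ (∧E₂ p)     = ∧E₂ (weaken σ p)
weaken σ (∨I₁ p)     = ∨I₁ (weaken σ p)
weaken σ (∨I₂ p)     = ∨I₂ (weaken σ p)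
weaken σ (∨E p q r)  = ∨E (weaken σ p) (weaken (∷⁺ʳ _ σ) q) (weaken (∷⁺ʳ _ σ) r)
weaken σ (⇒I p)      = ⇒I (weaken (∷⁺ʳ _ σ) p)
weaken σ (⇒E p q)    = ⇒E (weaken σ p) (weaken σ q)

weaken₁ : ∀ {Γ A B} → Γ ⊢ B → (A ∷ Γ) ⊢ B
weaken₁ = weaken there

hyp : ∀ {Γ A} → (A ∷ Γ) ⊢ A
hyp = ax (here refl)

cut : ∀ {Γ A B} → (A ∷ []) ⊢ B → Γ ⊢ A → Γ ⊢ B
cut p = ⇒E (⇒I (weaken (λ { (here e) → here e }) p))

subst-NotIn : ∀ x ψ A → NotIn x A → subst x ψ A ≡ A
subst-NotIn x ψ (var y) x≢y with x ≟ y
... | yes x≡y = contradiction x≡y x≢y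
... | no  _   = refl
subst-NotIn x ψ ⊤' _              = refl
subst-NotIn x ψ ⊥' _              = refl
subst-NotIn x ψ (A ∧' B) (na , nb) = cong₂ _∧'_ (subst-NotIn x ψ A na) (subst-NotIn x ψ B nb)
subst-NotIn x ψ (A ∨' B) (na , nb) = cong₂ _∨'_ (subst-NotIn x ψ A na) (subst-NotIn x ψ B nb)
subst-NotIn x ψ (A ⇒ B)  (na , nb) = cong₂ _⇒_ (subst-NotIn x ψ A na) (subst-NotIn x ψ B nb)

-- A position survives the removal unless it is the removed one, and then the entry there has both
-- properties.
Any-─ : ∀ {A : Set} {P Q : A → Set} {xs} (p : Any P xs) → Any Q xs →
        Any Q (xs ─ p) ⊎ ∃[ a ] P a × Q a
Any-─ (here pa) (here qa) = inj₂ (_ , pa , qa)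
Any-─ (here _)  (there q) = inj₁ q
Any-─ (there _) (here qa) = inj₁ (here qa)
Any-─ (there p) (there q) with Any-─ p q
... | inj₁ q′ = inj₁ (there q′)
... | inj₂ pq = inj₂ pq

module _ {x : ℕ} where

  infix 21 _[_] _⟨_⟩ _^_

  -- Recursion on the parse tree leaves heads and sides untouched by computation, so derivations
  -- need no rewriting along `subst-NotIn`.
  _[_] : Disj x → Formula → Formula
  dvar       [ ψ ] = ψ
  dimp α _ d [ ψ ] = α ⇒ d [ ψ ]
  dsid β _ d [ ψ ] = β ∨' d [ ψ ]
  dor d e    [ ψ ] = d [ ψ ] ∨' e [ ψ ]

  subst-⌜⌝ : ∀ ψ (d : Disj x) → subst x ψ ⌜ d ⌝ ≡ d [ ψ ]
  subst-⌜⌝ ψ dvar with x ≟ x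
  ... | yes _   = refl
  ... | no  x≢x = contradiction refl x≢x
  subst-⌜⌝ ψ (dimp α n d) = cong₂ _⇒_ (subst-NotIn x ψ α n) (subst-⌜⌝ ψ d)
  subst-⌜⌝ ψ (dsid β n d) = cong₂ _∨'_ (subst-NotIn x ψ β n) (subst-⌜⌝ ψ d)
  subst-⌜⌝ ψ (dor d e)    = cong₂ _∨'_ (subst-⌜⌝ ψ d) (subst-⌜⌝ ψ e)

  _⟨_⟩ : List (Disj x) → Formula → Formula
  ds ⟨ ψ ⟩ = foldr (λ d acc → d [ ψ ] ∧' acc) ⊤' ds

  subst-⋀ : ∀ ψ ds → subst x ψ (⋀ ds) ≡ ds ⟨ ψ ⟩
  subst-⋀ ψ []       = refl
  subst-⋀ ψ (d ∷ ds) = cong₂ _∧'_ (subst-⌜⌝ ψ d) (subst-⋀ ψ ds)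

  _^_ : List (Disj x) → ℕ → Formula
  ds ^ zero  = var x
  ds ^ suc n = ds ⟨ ds ^ n ⟩

  iter-⋀ : ∀ ds n → iter x (⋀ ds) n ≡ ds ^ n
  iter-⋀ ds zero    = refl
  iter-⋀ ds (suc n) = trans (subst-⋀ _ ds) (cong (ds ⟨_⟩) (iter-⋀ ds n))

  []-inflationary : ∀ {Γ ψ} (d : Disj x) → Γ ⊢ ψ → Γ ⊢ d [ ψ ]
  []-inflationary dvar         p = p
  []-inflationary (dimp _ _ d) p = ⇒I ([]-inflationary d (weaken₁ p))
  []-inflationary (dsid _ _ d) p = ∨I₂ ([]-inflationary d p)
  []-inflationary (dor d _)    p = ∨I₁ ([]-inflationary d p)

  ⟨⟩-inflationary : ∀ {Γ ψ} ds → Γ ⊢ ψ → Γ ⊢ ds ⟨ ψ ⟩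
  ⟨⟩-inflationary []       p = ⊤I
  ⟨⟩-inflationary (d ∷ ds) p = ∧I ([]-inflationary d p) (⟨⟩-inflationary ds p)

  []-mono : ∀ {Γ ψ χ} (d : Disj x) → Γ ⊢ (ψ ⇒ χ) → Γ ⊢ d [ ψ ] → Γ ⊢ d [ χ ]
  []-mono dvar         f p = ⇒E f p
  []-mono (dimp _ _ d) f p = ⇒I ([]-mono d (weaken₁ f) (⇒E (weaken₁ p) hyp))
  []-mono (dsid _ _ d) f p = ∨E p (∨I₁ hyp) (∨I₂ ([]-mono d (weaken₁ f) hyp))
  []-mono (dor d e)    f p = ∨E p (∨I₁ ([]-mono d (weaken₁ f) hyp)) (∨I₂ ([]-mono e (weaken₁ f) hyp))

  -- In use `ψ` and `χ` are consecutive iterates. The descent is asked for only under `α`, as it is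
  -- applied only inside an implication with head `α`.
  HeadwiseBelow : Ctx → Formula → Formula → List Formula → Set
  HeadwiseBelow Γ ψ χ hs = ∀ {α} → α ∈ hs → Γ ⊢ α ⊎ (α ∷ Γ) ⊢ (ψ ⇒ χ)

  HeadwiseBelow-weaken₁ : ∀ {Γ ψ χ hs A} → HeadwiseBelow Γ ψ χ hs → HeadwiseBelow (A ∷ Γ) ψ χ hs
  HeadwiseBelow-weaken₁ h m with h m
  ... | inj₁ p = inj₁ (weaken₁ p)
  ... | inj₂ p = inj₂ (weaken (∷⁺ʳ _ there) p)

  []-lower : ∀ {Γ ψ χ} (d : Disj x) → HeadwiseBelow Γ ψ χ (heads d) →
             Γ ⊢ d [ ψ ] → Γ ⊢ (d [ χ ] ∨' ψ)
  []-lower dvar h p = ∨I₂ p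
  []-lower (dimp α _ d) h p with h (here refl)
  -- In general `ψ` cannot be pulled out of `α ⇒ (A ∨' ψ)` intuitionistically; detaching the
  -- provable `α` first lets it surface.
  ... | inj₁ a = ∨E ([]-lower d (h ∘ there) (⇒E p a)) (∨I₁ (⇒I (weaken₁ hyp))) (∨I₂ hyp)
  ... | inj₂ f = ∨I₁ (⇒I ([]-mono d f (⇒E (weaken₁ p) hyp)))
  []-lower (dsid _ _ d) h p =
    ∨E p (∨I₁ (∨I₁ hyp))
         (∨E ([]-lower d (HeadwiseBelow-weaken₁ h) hyp) (∨I₁ (∨I₂ hyp)) (∨I₂ hyp))
  []-lower (dor d e) h p =
    ∨E p (∨E ([]-lower d (HeadwiseBelow-weaken₁ (h ∘ ∈-++⁺ˡ)) hyp) (∨I₁ (∨I₁ hyp)) (∨I₂ hyp))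
         (∨E ([]-lower e (HeadwiseBelow-weaken₁ (h ∘ ∈-++⁺ʳ (heads d))) hyp) (∨I₁ (∨I₂ hyp)) (∨I₂ hyp))

  -- The second premise absorbs the disjunct `ψ` left by `[]-lower`. It is a separate premise
  -- because `ds ⟨ χ ⟩` shrinks in the recursion while `ψ` stays fixed.
  ⟨⟩-lower : ∀ {Γ ψ χ} ds → HeadwiseBelow Γ ψ χ (allHeads ds) →
             (ψ ∷ Γ) ⊢ ds ⟨ χ ⟩ → Γ ⊢ ds ⟨ ψ ⟩ → Γ ⊢ ds ⟨ χ ⟩
  ⟨⟩-lower []       h b p = ⊤I
  ⟨⟩-lower (d ∷ ds) h b p =
    ∧I (∨E ([]-lower d (h ∘ ∈-++⁺ˡ) (∧E₁ p)) hyp (∧E₁ b))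
       (⟨⟩-lower ds (h ∘ ∈-++⁺ʳ (heads d)) (∧E₂ b) (∧E₂ p))

  CoveredModulo : Ctx → List Formula → List Formula → Set
  CoveredModulo Γ T hs = ∀ {α} → α ∈ hs → Γ ⊢ α ⊎ Any (α ≈_) T

  -- A head that was covered by the removed entry is equivalent to `α` through it, hence provable
  -- once `α` is assumed.
  CoveredModulo-─ : ∀ {Γ T hs α} → CoveredModulo Γ T hs → (t : Any (α ≈_) T) →
                    CoveredModulo (α ∷ Γ) (T ─ t) hs
  CoveredModulo-─ c t m with c m
  ... | inj₁ p = inj₁ (weaken₁ p)
  ... | inj₂ u with Any-─ t u
  ...   | inj₁ u′ = inj₂ u′
  ...   | inj₂ (_ , (α⊢t , _) , (_ , t⊢β)) = inj₁ (cut t⊢β (cut α⊢t hyp))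

  length-─ : ∀ {α T k} (t : Any (α ≈_) T) → length T ≤ suc k → length (T ─ t) ≤ k
  length-─ {T = T} t l = ≤-trans (≤-reflexive (length-removeAt T (index t))) (pred-mono-≤ l)

  -- Induction on `k`: each newly assumed head uses up one entry of `T` and one iterate. The bound
  -- is an inequality so that one `T` serves several exponents.
  descent : ∀ {Γ} ds k T → length T ≤ k → CoveredModulo Γ T (allHeads ds) →
            Γ ⊢ (ds ^ suc (suc k) ⇒ ds ^ suc k)
  -- With `χ` the iterate `ds ^ k`, `ds ⟨ χ ⟩` is `ψ` by definition, so the first `hyp` suffices.
  descent {Γ} ds k T l c = ⇒I (⟨⟩-lower ds (HeadwiseBelow-weaken₁ (below k T l c)) hyp hyp)
    where
    below : ∀ k T → length T ≤ k → CoveredModulo Γ T (allHeads ds) →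
            HeadwiseBelow Γ (ds ^ suc k) (ds ^ k) (allHeads ds)
    below k T l c m with c m
    ... | inj₁ p = inj₁ p
    -- For `k` zero `T` is empty, so every head is provable and no descent to `ds ^ zero` is
    -- required.
    below zero    (_ ∷ _) () c m | inj₂ t
    below (suc k) T       l  c m | inj₂ t =
      inj₂ (descent ds k (T ─ t) (length-─ t l) (CoveredModulo-─ c t))

theorem7p13 : (x : ℕ) (φs : List (Disj x)) (Hs Ss : List Formula) →
    CoveredBy (allHeads φs) Hs → CoveredBy (allSides φs) Ss →
    RuitenburgLE x (⋀ φs) (suc (length Hs) * suc (length Ss))
theorem7p13 x φs Hs Ss cH cS =
  n , m≤m*n n (suc (length Ss)) ,
  subst₂ _≈_ (sym (iter-⋀ φs (suc (suc n)))) (sym (iter-⋀ φs n))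
    -- Two descents, from `n + 2` to `n + 1` and then to `n`.
    ( ⇒E (lower ≤-refl) (⇒E (lower (n≤1+n _)) hyp)
    , ⟨⟩-inflationary φs (⟨⟩-inflationary φs hyp))
  where
  n = suc (length Hs)

  lower : ∀ {Γ k} → length Hs ≤ k → Γ ⊢ (φs ^ suc (suc k) ⇒ φs ^ suc k)
  lower l = descent φs _ Hs l (inj₂ ∘ cH)
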